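{- Let $X$ be a tree-graded graph with pieces $(X_i)_{i\in I}$. Then for every $r\in\mathbb N$, \[ \operatorname{tw}_X(r) = \max\{\operatorname{tw}_{X_i}(r) : i\in I\}. \]
   Context: Let $X$ be a graph and let $\{X_i\}_{i\in I}$ be a family of connected subgraphs of $X$. $X$ is tree-graded with respect to $\{X_i\}_{i\in I}$ (equivalently, tree-graded with pieces $(X_i)_{i\in I}$) if: (a) $X=\bigcup_{i\in I}X_i$; (b) for $i,j\in I$ with $i\neq j$, $X_i\cap X_j$ is either empty or a single vertex; (c) every simple loop in $X$ is contained in some $X_i$. A tree-decomposition of a graph $\Gamma=(V\Gamma,E\Gamma)$ is a pair $(T,\{B_g\}_{g\in VT})$, where $T=(VT,ET)$ is a tree, each $B_g\subseteq V\Gamma$, and: (1) $\bigcup_{g\in VT}B_g=V\Gamma$; (2) for every edge $vw\in E\Gamma$ there is some $g\in VT$ with $v,w\in B_g$; (3) for each $v\in V\Gamma$, the full subgraph of $T$ with vertex set $\{g\in VT : v\in B_g\}$ is connected. Its width is $\max_{g\in VT}|B_g|-1$, and the treewidth $\operatorname{tw}(\Gamma)$ is the minimum width of a tree-decomposition of $\Gamma$. The treewidth profile of a graph $X$ is the function $\operatorname{tw}_X:\mathbb N\to\mathbb N$, $\operatorname{tw}_X(r)=\max\{\operatorname{tw}(\Gamma) : \Gamma\leq X,\ |V\Gamma|\leq r\}$, where $\Gamma\leq X$ means $\Gamma$ is a (finite) subgraph of $X$. -}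

module Defs where

open import Level using (Level; 0ℓ; _⊔_)
open import Data.Nat.Base using (ℕ; _∸_; _≤_)
open import Data.List.Base using (List; []; _∷_; _++_; length)
open import Data.List.Membership.Propositional using () renaming (_∈_ to _∈ˡ_)
open import Data.List.Relation.Unary.Linked using (Linked)
open import Data.List.Relation.Unary.Unique.Propositional using (Unique)
open import Data.Product.Base using (Σ-syntax; ∃-syntax; _×_; _,_; proj₁)
open import Data.Sum.Base using (_⊎_)
open import Relation.Binary.Core using (Rel; _⇒_; _⇔_)
open import Relation.Binary.Definitions using (Symmetric; Irreflexive)
open import Relation.Binary.Construct.Closure.ReflexiveTransitive using (Star)
open import Relation.Binary.PropositionalEquality.Core using (_≡_; _≢_)
open import Relation.Nullary.Negation.Core using (¬_)
open import Relation.Unary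
  using (Pred; _∈_; _⊆_; _≐_; _∩_; ｛_｝; ⋃; Empty; Satisfiable)

private
  variable
    a b : Level
    U : Set

-- Simple undirected graphs (possibly infinite) whose vertices form a subset of
-- the type U. A graph and its subgraphs then share the same U, so that
-- subgraphs, unions and intersections are the literal set-theoretic ones.
record Graph (U : Set) : Set₁ where
  field
    V      : Pred U 0ℓ
    E      : Rel U 0ℓ
    E⇒V    : ∀ {v w} → E v w → v ∈ V
    sym    : Symmetric E
    irrefl : Irreflexive _≡_ E

open Graph public using (V; E)

infix 4 _⊑_

_⊑_ : Graph U → Graph U → Set
Γ ⊑ X = (V Γ ⊆ V X) × (E Γ ⇒ E X)

-- A path along edges stays inside the vertex set by E⇒V. The empty graph
-- counts as connected.
Connected : Graph U → Set
Connected X = ∀ {v w} → v ∈ V X → w ∈ V X → Star (E X) v w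

-- The full subgraph of X on the vertices lying in S.
full : Graph U → Pred U 0ℓ → Graph U
full X S = record
  { V      = V X ∩ S
  ; E      = λ v w → E X v w × v ∈ S × w ∈ S
  ; E⇒V    = λ (e , p , _) → Graph.E⇒V X e , p
  ; sym    = λ (e , p , q) → Graph.sym X e , q , p
  ; irrefl = λ eq (e , _) → Graph.irrefl X eq e
  }

-- The loop v, v₁, …, vₙ, v (n ≥ 2) with v, v₁, …, vₙ distinct, given by v and
-- the list of the vᵢ. Since the predicate only asks for the edges to be in X,
-- a loop of X is contained in a subgraph Y exactly when it is a loop of Y.
IsSimpleLoop : Graph U → U → List U → Set
IsSimpleLoop X v vs =
  (2 ≤ length vs) × Unique (v ∷ vs) × Linked (E X) (v ∷ vs ++ v ∷ [])

record TreeGraded {I : Set} (X : Graph U) (P : I → Graph U) : Set where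
  field
    subgraph     : ∀ i → P i ⊑ X
    connected    : ∀ i → Connected (P i)
    vertex-cover : V X ≐ ⋃ I (λ i → V (P i))
    edge-cover   : E X ⇔ (λ v w → ∃[ i ] E (P i) v w)
    -- An intersection of graphs with at most one vertex has no edges, so only
    -- the vertex sets need to be compared.
    intersection : ∀ {i j} → i ≢ j →
                   Empty (V (P i) ∩ V (P j)) ⊎
                   (∃[ v ] (V (P i) ∩ V (P j)) ≐ ｛ v ｝)
    simple-loop  : ∀ {v vs} → IsSimpleLoop X v vs →
                   ∃[ i ] IsSimpleLoop (P i) v vs

record IsTree (T : Graph U) : Set where
  field
    nonempty  : Satisfiable (V T)
    connected : Connected T
    acyclic   : ∀ {v vs} → ¬ IsSimpleLoop T v vs

record TreeDecomposition (Γ : Graph U) : Set₁ where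
  field
    {W}          : Set
    T            : Graph W
    isTree       : IsTree T
    -- Only the bags at vertices of T are relevant.
    bag          : W → Pred U 0ℓ
    bag⊆V        : ∀ {g} → g ∈ V T → bag g ⊆ V Γ
    vertex-cover : ∀ {v} → v ∈ V Γ → ∃[ g ] (g ∈ V T × v ∈ bag g)
    edge-cover   : ∀ {v w} → E Γ v w → ∃[ g ] (g ∈ V T × v ∈ bag g × w ∈ bag g)
    coherent     : ∀ {v} → v ∈ V Γ → Connected (full T (λ g → v ∈ bag g))

HasSize : Pred U 0ℓ → ℕ → Set
HasSize S n = ∃[ xs ] (Unique xs × S ≐ (_∈ˡ xs) × length xs ≡ n)

-- Numerical invariants are functional relations: f x m says that the value at
-- x is defined and equals m. IsMaximum f k says that all values are defined and
-- that k is the largest of them; in particular A is inhabited.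
IsMaximum : {A : Set a} → (A → Pred ℕ b) → ℕ → Set (a ⊔ b)
IsMaximum f k = (∃[ x ] f x k) × (∀ x → ∃[ m ] (f x m × m ≤ k))

IsMinimum : Pred ℕ a → ℕ → Set a
IsMinimum S k = S k × (∀ {m} → S m → k ≤ m)

-- The monus only matters for the empty graph, whose width is 0 rather than -1,
-- so that treewidth takes values in ℕ.
HasWidth : {Γ : Graph U} → TreeDecomposition Γ → ℕ → Set
HasWidth D w =
  ∃[ k ] (IsMaximum {A = Σ[ g ∈ W ] g ∈ V T} (λ x → HasSize (bag (proj₁ x))) k ×
          w ≡ k ∸ 1)
  where open TreeDecomposition D

IsTreewidth : Graph U → ℕ → Set₁
IsTreewidth Γ = IsMinimum (λ w → Σ[ D ∈ TreeDecomposition Γ ] HasWidth D w)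

record SubgraphOfSize≤ (r : ℕ) (X : Graph U) : Set₁ where
  field
    Γ     : Graph U
    Γ⊑X   : Γ ⊑ X
    small : ∃[ n ] (HasSize (V Γ) n × n ≤ r)

-- IsProfile X r k says tw_X(r) = k.
IsProfile : Graph U → ℕ → ℕ → Set₁
IsProfile X r =
  IsMaximum {A = SubgraphOfSize≤ r X} (λ S → IsTreewidth (SubgraphOfSize≤.Γ S))

{-# OPTIONS --safe #-}
-- A finite graph Γ ⊑ X that no set of at most one vertex separates lies in a
-- single piece: two consecutive edges uv, vw of Γ with u ≢ w lie on a simple
-- loop, because u and w are joined by a simple path avoiding v; the loop lies in
-- some piece, and distinct pieces share no edge, so the piece containing uv
-- contains vw, and hence every edge of Γ. Any other finite Γ ⊑ X is a union of
-- two smaller full subgraphs with at most one common vertex, and their tree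
-- decompositions are glued by an edge between two bags containing that vertex.
module Submission where

open import Defs
open import Level using (Level; 0ℓ; lift; lower) renaming (suc to lsuc)
open import Axiom.ExcludedMiddle using (ExcludedMiddle)
open import Data.Nat.Base as ℕ using (ℕ; zero; suc; _∸_; _≤_; _<_; z≤n; s≤s)
open import Data.Nat.Induction using (<-rec)
open import Data.Nat.Properties
  using (≤-refl; ≤-trans; <⇒≤; ≮⇒≥; m∸n≤m; m≤n+m; m≤m⊔n; m≤n⊔m;
         ⊔-sel; m≤n⇒m<n∨m≡n; n≤0⇒n≡0)
open import Data.List.Base using (List; []; _∷_; _++_; length; map; filter)
open import Data.List.Properties using (map-++; length-map; length-++; filter-notAll)
open import Data.List.Membership.Propositional using (lose) renaming (_∈_ to _∈ˡ_)
open import Data.List.Membership.Propositional.Properties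
  using (∈-filter⁺; ∈-filter⁻)
open import Data.List.Relation.Unary.All using (All; []; _∷_)
open import Data.List.Relation.Unary.All.Properties using (¬Any⇒All¬; All¬⇒¬Any)
open import Data.List.Relation.Unary.Any using (here; there; any?)
open import Data.List.Relation.Unary.AllPairs using ([]; _∷_)
open import Data.List.Relation.Unary.Linked as Linked using (Linked; [-]; _∷_)
import Data.List.Relation.Unary.Linked.Properties as Linkedₚ
open import Data.List.Relation.Unary.Unique.Propositional using (Unique)
import Data.List.Relation.Unary.Unique.Propositional.Properties as Uniqueₚ
open import Data.Product.Base
  using (Σ-syntax; ∃-syntax; _×_; _,_; proj₁; proj₂)
open import Data.Sum.Base using (_⊎_; inj₁; inj₂; [_,_]′)
open import Data.Sum.Properties using (inj₁-injective; inj₂-injective)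
open import Data.Unit.Base using (⊤; tt)
open import Data.Empty using (⊥)
open import Function.Base using (_∘_; id)
open import Relation.Binary.Core using (Rel)
open import Relation.Binary.Definitions using (DecidableEquality; Symmetric)
open import Relation.Binary.Construct.Closure.ReflexiveTransitive as Star
  using (Star; ε; _◅_; _◅◅_)
open import Relation.Binary.PropositionalEquality
  using (_≡_; _≢_; refl; sym; trans; cong; subst)
open import Relation.Nullary using (¬_; yes; no; contradiction)
open import Relation.Nullary.Decidable using (map′; decidable-stable)
open import Relation.Unary using (Pred; _∈_; _⊆_; _∩_; ∁; ∅; ｛_｝)

private
  variable
    a b ℓ : Level
    A : Set a
    U : Set

-- Minima and maxima

minimum : ExcludedMiddle ℓ → {S : Pred ℕ ℓ} → ∀ {n} → S n → ∃[ m ] IsMinimum S m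
minimum em {S} {n} = <-rec (λ n → S n → ∃[ m ] IsMinimum S m) step n
  where
  step : ∀ n → (∀ {m} → m < n → S m → ∃[ l ] IsMinimum S l) →
         S n → ∃[ m ] IsMinimum S m
  step n rec s with em {∃[ m ] (m < n × S m)}
  ... | yes (m , m<n , t) = rec m<n t
  ... | no none           = n , s , λ {m} t → ≮⇒≥ λ m<n → none (m , m<n , t)

-- Descent on the bound: either the bound itself lies in `S`, or every element of `S` below it also
-- satisfies the next smaller bound. At bound 0 the given element must be 0.
greatest≤ : ExcludedMiddle ℓ → {S : Pred ℕ ℓ} → ∀ r {n} → S n → n ≤ r →
            ∃[ k ] (S k × k ≤ r × (∀ {m} → S m → m ≤ r → m ≤ k))
greatest≤ em {S} zero s n≤0 = 0 , subst S (n≤0⇒n≡0 n≤0) s , z≤n , λ _ m≤0 → m≤0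
greatest≤ em {S} (suc r) {n} s n≤1+r with em {S (suc r)}
... | yes t = suc r , t , ≤-refl , λ _ m≤1+r → m≤1+r
... | no ¬t =
  let k , t , k≤r , max = greatest≤ em r s (strict s n≤1+r)
  in  k , t , ≤-trans k≤r (m≤n+m r 1) , λ u m≤1+r → max u (strict u m≤1+r)
  where
  strict : ∀ {m} → S m → m ≤ suc r → m ≤ r
  strict u m≤1+r with m≤n⇒m<n∨m≡n m≤1+r
  ... | inj₁ (s≤s m≤r) = m≤r
  ... | inj₂ refl      = contradiction u ¬t

-- The uniform bound `r` gives the set of all values a greatest element; `x₀` makes that set
-- nonempty.
maximum≤ : {f : A → Pred ℕ b} → ExcludedMiddle _ → A →
           ∀ r → (∀ x → ∃[ m ] (f x m × m ≤ r)) →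
           ∃[ k ] (IsMaximum f k × k ≤ r)
maximum≤ {f = f} em x₀ r value =
  let m , fm , m≤r     = value x₀
      k , at , k≤r , max = greatest≤ em {λ m → ∃[ x ] f x m} r (x₀ , fm) m≤r
  in  k , (at , λ x → let m , fm , m≤r = value x in m , fm , max (x , fm) m≤r) , k≤r

-- Lists and paths

All-preimages : {B : Set b} {f : B → A} {xs : List A} →
                All (λ x → ∃[ y ] x ≡ f y) xs → ∃[ ys ] xs ≡ map f ys
All-preimages []                 = [] , refl
All-preimages ((y , refl) ∷ pre) =
  let ys , eq = All-preimages pre in y ∷ ys , cong (_ ∷_) eq

module _ {R : Rel A ℓ} where

  Linked⇒All : {P : Pred A b} → (∀ {x y} → R x y → P y) →
               ∀ {x xs} → P x → Linked R (x ∷ xs) → All P (x ∷ xs)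
  Linked⇒All f px [-]      = px ∷ []
  Linked⇒All f px (r ∷ rs) = px ∷ Linked⇒All f (f r) rs

  Linked-∷ʳ⁺ : ∀ xs {x y} → Linked R (xs ++ x ∷ []) → R x y →
               Linked R ((xs ++ x ∷ []) ++ y ∷ [])
  Linked-∷ʳ⁺ []           [-]      e = e ∷ [-]
  Linked-∷ʳ⁺ (_ ∷ [])     (r ∷ rs) e = r ∷ Linked-∷ʳ⁺ [] rs e
  Linked-∷ʳ⁺ (_ ∷ y ∷ xs) (r ∷ rs) e = r ∷ Linked-∷ʳ⁺ (y ∷ xs) rs e

  Linked-last : ∀ xs {x y} → Linked R ((xs ++ x ∷ []) ++ y ∷ []) → R x y
  Linked-last []           (r ∷ _)  = r
  Linked-last (_ ∷ [])     (_ ∷ rs) = Linked-last [] rs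
  Linked-last (_ ∷ y ∷ xs) (_ ∷ rs) = Linked-last (y ∷ xs) rs

  SimplePath : A → A → List A → Set _
  SimplePath u w zs = Linked R (u ∷ zs ++ w ∷ []) × Unique (u ∷ zs ++ w ∷ [])

  simplePath-suffix : ∀ {u w} → u ≢ w → ∀ ys → u ∈ˡ ys ++ w ∷ [] →
                      Linked R (ys ++ w ∷ []) → Unique (ys ++ w ∷ []) →
                      ∃[ zs ] SimplePath u w zs
  simplePath-suffix u≢w []       (here u≡w)  _      _          = contradiction u≡w u≢w
  simplePath-suffix u≢w (y ∷ ys) (here refl) linked uniq       = ys , linked , uniq
  simplePath-suffix u≢w (y ∷ ys) (there u∈)  linked (_ ∷ uniq) =
    simplePath-suffix u≢w ys u∈ (Linked.tail linked) uniq

  -- Induction on the walk. If the new first vertex already occurs on the simple path found for the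
  -- rest, that path is cut to the suffix starting there.
  Star⇒simplePath : DecidableEquality A → ∀ {u w} → Star R u w → u ≢ w →
                    ∃[ zs ] SimplePath u w zs
  Star⇒simplePath _≟_ ε u≢u = contradiction refl u≢u
  Star⇒simplePath _≟_ {u} {w} (_◅_ {j = x} e p) u≢w with x ≟ w
  ... | yes refl = [] , e ∷ [-] , (u≢w ∷ []) ∷ [] ∷ []
  ... | no x≢w with Star⇒simplePath _≟_ p x≢w
  ... | zs , linked , uniq with any? (u ≟_) (x ∷ zs ++ w ∷ [])
  ... | yes u∈ = simplePath-suffix u≢w (x ∷ zs) u∈ linked uniq
  ... | no u∉  = x ∷ zs , e ∷ linked , ¬Any⇒All¬ _ u∉ ∷ uniq

-- Gluing two trees along a new edge

-- If ab is the only edge between the sides L and L′, a simple loop starting in L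
-- stays in L: after entering b from a, it could only come back through ba.
module _ {R : Rel A 0ℓ} {L L′ : Pred A 0ℓ} {a b : A}
         (side  : ∀ x → x ∈ L ⊎ x ∈ L′)
         (enter : ∀ {x y} → R x y → x ∈ L → y ∈ L′ → x ≡ a × y ≡ b)
         (leave : ∀ {x y} → R x y → x ∈ L′ → y ∈ L → x ≡ b × y ≡ a)
         where

  leaves-through : ∀ {x v} xs → x ∈ L′ → v ∈ L → Linked R (x ∷ xs ++ v ∷ []) →
                   b ∈ˡ x ∷ xs
  leaves-through []       x∈L′ v∈L (r ∷ _)  = here (sym (proj₁ (leave r x∈L′ v∈L)))
  leaves-through (y ∷ ys) x∈L′ v∈L (r ∷ rs) with side y
  ... | inj₁ y∈L  = here (sym (proj₁ (leave r x∈L′ y∈L)))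
  ... | inj₂ y∈L′ = there (leaves-through ys y∈L′ v∈L rs)

  -- Induction along the walk from the current vertex `u` to the base `v`. The length condition
  -- excludes `a`, `b`, `a`, which crosses and returns at once; after the first step `u` differs
  -- from `v` and the condition is vacuous.
  loop-stays : ∀ {v u} ws → v ∈ L → u ∈ L → (u ≡ v → 2 ≤ length ws) →
               All (v ≢_) ws → Unique (u ∷ ws) → Linked R (u ∷ ws ++ v ∷ []) →
               All L ws
  loop-stays [] _ _ _ _ _ _ = []
  loop-stays (w ∷ ws) v∈L u∈L long (v≢w ∷ v≢ws) (u≢ ∷ uniq) (r ∷ rs) with side w
  ... | inj₁ w∈L =
    w∈L ∷ loop-stays ws v∈L w∈L (λ w≡v → contradiction (sym w≡v) v≢w) v≢ws uniq rs
  -- Crossing and returning at once forces both `u` and `v` to be `a`.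
  loop-stays (w ∷ []) v∈L u∈L long _ _ (r ∷ r′ ∷ [-]) | inj₂ w∈L′
    with long (trans (proj₁ (enter r u∈L w∈L′)) (sym (proj₂ (leave r′ w∈L′ v∈L))))
  ... | s≤s ()
  -- Here `w` is `b`. If `x` is back in `L`, it repeats `a`, which is `u`; otherwise the later
  -- return passes through `b` a second time.
  loop-stays (w ∷ x ∷ xs) v∈L u∈L _ _ ((_ ∷ u≢x ∷ _) ∷ w≢ ∷ _) (r ∷ r′ ∷ rs) | inj₂ w∈L′
    with enter r u∈L w∈L′ | side x
  ... | refl , refl | inj₁ x∈L  = contradiction (sym (proj₂ (leave r′ w∈L′ x∈L))) u≢x
  ... | refl , refl | inj₂ x∈L′ =
    contradiction (leaves-through xs x∈L′ v∈L rs) (All¬⇒¬Any w≢)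

simpleLoop-preimage :
  {A B : Set} (G : Graph A) (H : Graph B) {f : A → B} →
  (∀ {x y} → E H (f x) (f y) → E G x y) →
  ∀ {v vs} → IsSimpleLoop H (f v) vs → All (λ w → ∃[ x ] w ≡ f x) vs →
  ∃[ xs ] IsSimpleLoop G v xs
simpleLoop-preimage G H {f} reflect {v} (long , uniq , linked) pre
  with All-preimages pre
... | xs , refl =
  xs , subst (2 ≤_) (length-map f xs) long , Uniqueₚ.map⁻ uniq ,
  Linked.map reflect
    (Linkedₚ.map⁻ (subst (Linked (E H)) (cong (f v ∷_) (sym (map-++ f xs (v ∷ [])))) linked))

-- Stated for predicates and relations so that it serves both the whole glued tree and the nodes
-- whose bags contain a fixed vertex. A bridge is demanded only when both sides are inhabited, since
-- a vertex may occur on one side only.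
connected-⊎ :
  {A B : Set} {Q₁ : Pred A 0ℓ} {Q₂ : Pred B 0ℓ}
  {R₁ : Rel A 0ℓ} {R₂ : Rel B 0ℓ} {R : Rel (A ⊎ B) 0ℓ} →
  (∀ {x y} → R₁ x y → R (inj₁ x) (inj₁ y)) →
  (∀ {x y} → R₂ x y → R (inj₂ x) (inj₂ y)) →
  Symmetric R →
  (∀ {x y} → x ∈ Q₁ → y ∈ Q₁ → Star R₁ x y) →
  (∀ {x y} → x ∈ Q₂ → y ∈ Q₂ → Star R₂ x y) →
  (∀ {x y} → x ∈ Q₁ → y ∈ Q₂ →
    ∃[ a ] ∃[ b ] (a ∈ Q₁ × b ∈ Q₂ × R (inj₁ a) (inj₂ b))) →
  ∀ x y → x ∈ [ Q₁ , Q₂ ]′ → y ∈ [ Q₁ , Q₂ ]′ → Star R x y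
connected-⊎ {Q₁ = Q₁} {Q₂} {R = R} f₁ f₂ R-sym c₁ c₂ bridge = go
  where
  across : ∀ {x y} → x ∈ Q₁ → y ∈ Q₂ → Star R (inj₁ x) (inj₂ y)
  across p q =
    let a , b , a∈ , b∈ , e = bridge p q
    in  Star.gmap inj₁ f₁ (c₁ p a∈) ◅◅ e ◅ Star.gmap inj₂ f₂ (c₂ b∈ q)

  go : ∀ x y → x ∈ [ Q₁ , Q₂ ]′ → y ∈ [ Q₁ , Q₂ ]′ → Star R x y
  go (inj₁ x) (inj₁ y) p q = Star.gmap inj₁ f₁ (c₁ p q)
  go (inj₁ x) (inj₂ y) p q = across p q
  go (inj₂ x) (inj₁ y) p q = Star.reverse R-sym (across q p)
  go (inj₂ x) (inj₂ y) p q = Star.gmap inj₂ f₂ (c₂ p q)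

module _ {W₁ W₂ : Set} (T₁ : Graph W₁) (T₂ : Graph W₂) {a : W₁} {b : W₂}
         (a∈ : a ∈ V T₁) (b∈ : b ∈ V T₂) where

  data BridgedEdge : Rel (W₁ ⊎ W₂) 0ℓ where
    left     : ∀ {x y} → E T₁ x y → BridgedEdge (inj₁ x) (inj₁ y)
    right    : ∀ {x y} → E T₂ x y → BridgedEdge (inj₂ x) (inj₂ y)
    forward  : BridgedEdge (inj₁ a) (inj₂ b)
    backward : BridgedEdge (inj₂ b) (inj₁ a)

  bridged : Graph (W₁ ⊎ W₂)
  bridged = record
    { V      = [ V T₁ , V T₂ ]′
    ; E      = BridgedEdge
    ; E⇒V    = E⇒V
    ; sym    = sym′
    ; irrefl = irrefl
    }
    where
    E⇒V : ∀ {x y} → BridgedEdge x y → x ∈ [ V T₁ , V T₂ ]′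
    E⇒V (left e)  = Graph.E⇒V T₁ e
    E⇒V (right e) = Graph.E⇒V T₂ e
    E⇒V forward   = a∈
    E⇒V backward  = b∈

    sym′ : Symmetric BridgedEdge
    sym′ (left e)  = left (Graph.sym T₁ e)
    sym′ (right e) = right (Graph.sym T₂ e)
    sym′ forward   = backward
    sym′ backward  = forward

    irrefl : ∀ {x y} → x ≡ y → ¬ BridgedEdge x y
    irrefl eq (left e)  = Graph.irrefl T₁ (inj₁-injective eq) e
    irrefl eq (right e) = Graph.irrefl T₂ (inj₂-injective eq) e

  private
    IsLeft IsRight : Pred (W₁ ⊎ W₂) 0ℓ
    IsLeft  x = ∃[ y ] x ≡ inj₁ y
    IsRight x = ∃[ y ] x ≡ inj₂ y

    left-or-right : ∀ x → x ∈ IsLeft ⊎ x ∈ IsRight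
    left-or-right (inj₁ y) = inj₁ (y , refl)
    left-or-right (inj₂ y) = inj₂ (y , refl)

    right-or-left : ∀ x → x ∈ IsRight ⊎ x ∈ IsLeft
    right-or-left (inj₁ y) = inj₂ (y , refl)
    right-or-left (inj₂ y) = inj₁ (y , refl)

    crosses-forward : ∀ {x y} → BridgedEdge x y → x ∈ IsLeft → y ∈ IsRight →
                      x ≡ inj₁ a × y ≡ inj₂ b
    crosses-forward forward  _        _        = refl , refl
    crosses-forward (left _)  _        (_ , ())
    crosses-forward (right _) (_ , ()) _
    crosses-forward backward  (_ , ()) _

    crosses-backward : ∀ {x y} → BridgedEdge x y → x ∈ IsRight → y ∈ IsLeft →
                       x ≡ inj₂ b × y ≡ inj₁ a
    crosses-backward backward  _        _        = refl , refl
    crosses-backward (left _)  (_ , ()) _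
    crosses-backward (right _) _        (_ , ())
    crosses-backward forward   (_ , ()) _

  -- A loop stays on the side of its base vertex and so pulls back to a loop of that tree. For a
  -- base on the right, the two sides and the ends of the bridge are interchanged.
  bridged-acyclic : (∀ {v vs} → ¬ IsSimpleLoop T₁ v vs) →
                    (∀ {v vs} → ¬ IsSimpleLoop T₂ v vs) →
                    ∀ v {vs} → ¬ IsSimpleLoop bridged v vs
  bridged-acyclic ac₁ ac₂ (inj₁ v) {vs} loop@(long , uniq@(v≢ ∷ _) , linked) =
    ac₁ (proj₂ (simpleLoop-preimage T₁ bridged (λ { (left e) → e }) loop
      (loop-stays left-or-right crosses-forward crosses-backward
        vs (v , refl) (v , refl) (λ _ → long) v≢ uniq linked)))
  bridged-acyclic ac₁ ac₂ (inj₂ v) {vs} loop@(long , uniq@(v≢ ∷ _) , linked) =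
    ac₂ (proj₂ (simpleLoop-preimage T₂ bridged (λ { (right e) → e }) loop
      (loop-stays right-or-left crosses-backward crosses-forward
        vs (v , refl) (v , refl) (λ _ → long) v≢ uniq linked)))

  bridged-isTree : IsTree T₁ → IsTree T₂ → IsTree bridged
  bridged-isTree t₁ t₂ = record
    { nonempty  = inj₁ a , a∈
    ; connected = λ {x} {y} → connected-⊎ left right (Graph.sym bridged)
                    (IsTree.connected t₁) (IsTree.connected t₂)
                    (λ _ _ → a , b , a∈ , b∈ , forward) x y
    ; acyclic   = λ {v} →
                    bridged-acyclic (IsTree.acyclic t₁) (IsTree.acyclic t₂) v
    }

-- Tree decompositions of bounded width

-- An upper bound on treewidth that carries its decomposition, so that bounds can be glued without
-- minimality.
WidthAtMost : Graph U → ℕ → Set₁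
WidthAtMost Γ k = Σ[ D ∈ TreeDecomposition Γ ] ∃[ w ] (HasWidth D w × w ≤ k)

treewidth≤ : ExcludedMiddle (lsuc 0ℓ) → {Γ : Graph U} → ∀ {k} →
             WidthAtMost Γ k → ∃[ m ] (IsTreewidth Γ m × m ≤ k)
treewidth≤ em (D , w , width , w≤k) =
  let m , min = minimum em (D , width)
  in  m , min , ≤-trans (proj₂ min (D , width)) w≤k

singleBag : {Γ : Graph U} → ∀ {n} → HasSize (V Γ) n → WidthAtMost Γ n
singleBag {Γ = Γ} {n} size =
  D , n ∸ 1 , (n , (((tt , tt) , size) , λ _ → n , size , ≤-refl) , refl) , m∸n≤m n 1
  where
  point : Graph ⊤
  point = record
    { V = λ _ → ⊤ ; E = λ _ _ → ⊥ ; E⇒V = λ () ; sym = λ () ; irrefl = λ _ () }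

  D : TreeDecomposition Γ
  D = record
    { T            = point
    ; isTree       = record
      { nonempty  = tt , tt
      ; connected = λ _ _ → ε
      ; acyclic   = λ { {vs = []} (_ , _ , () ∷ _) ; {vs = _ ∷ _} (_ , _ , () ∷ _) }
      }
    ; bag          = λ _ → V Γ
    ; bag⊆V        = λ _ → id
    ; vertex-cover = λ v∈ → tt , tt , v∈
    ; edge-cover   = λ e → tt , tt , Graph.E⇒V Γ e , Graph.E⇒V Γ (Graph.sym Γ e)
    ; coherent     = λ _ _ _ → ε
    }

Subsingleton : {A : Set} → Pred A 0ℓ → Set
Subsingleton C = ∀ {x y} → x ∈ C → y ∈ C → x ≡ y

-- Gluing two tree decompositions

module _ {Γ : Graph U} {S₁ S₂ : Pred U 0ℓ}
         (covers : ∀ {v} → v ∈ V Γ → v ∈ S₁ ⊎ v ∈ S₂)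
         (covers-edge : ∀ {v w} → E Γ v w → (v ∈ S₁ × w ∈ S₁) ⊎ (v ∈ S₂ × w ∈ S₂))
         where

  module _ (D₁ : TreeDecomposition (full Γ S₁)) (D₂ : TreeDecomposition (full Γ S₂))
           where
    private
      module D₁ = TreeDecomposition D₁
      module D₂ = TreeDecomposition D₂

    module _ {a b} (a∈ : a ∈ V D₁.T) (b∈ : b ∈ V D₂.T)
             (common : ∀ {v} → v ∈ V Γ → v ∈ S₁ → v ∈ S₂ →
                       v ∈ D₁.bag a × v ∈ D₂.bag b)
             where

      -- By `common`, every vertex shared by the two sides lies in both bags joined by the new edge,
      -- so its set of nodes stays connected.
      glueAt : TreeDecomposition Γ
      glueAt = record
        { T            = T
        ; isTree       = bridged-isTree D₁.T D₂.T a∈ b∈ D₁.isTree D₂.isTree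
        ; bag          = bag
        ; bag⊆V        = λ {g} → bag⊆V g
        ; vertex-cover = vertex-cover
        ; edge-cover   = edge-cover
        ; coherent     = coherent
        }
        where
        T = bridged D₁.T D₂.T a∈ b∈

        bag : D₁.W ⊎ D₂.W → Pred U 0ℓ
        bag = [ D₁.bag , D₂.bag ]′

        bag⊆V : ∀ g → g ∈ V T → bag g ⊆ V Γ
        bag⊆V (inj₁ g) g∈ p = proj₁ (D₁.bag⊆V g∈ p)
        bag⊆V (inj₂ g) g∈ p = proj₁ (D₂.bag⊆V g∈ p)

        vertex-cover : ∀ {v} → v ∈ V Γ → ∃[ g ] (g ∈ V T × v ∈ bag g)
        vertex-cover v∈ with covers v∈
        ... | inj₁ v∈S₁ = let g , p = D₁.vertex-cover (v∈ , v∈S₁) in inj₁ g , p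
        ... | inj₂ v∈S₂ = let g , p = D₂.vertex-cover (v∈ , v∈S₂) in inj₂ g , p

        edge-cover : ∀ {v w} → E Γ v w → ∃[ g ] (g ∈ V T × v ∈ bag g × w ∈ bag g)
        edge-cover e with covers-edge e
        ... | inj₁ vw∈S₁ = let g , p = D₁.edge-cover (e , vw∈S₁) in inj₁ g , p
        ... | inj₂ vw∈S₂ = let g , p = D₂.edge-cover (e , vw∈S₂) in inj₂ g , p

        coherent : ∀ {v} → v ∈ V Γ → Connected (full T (λ g → v ∈ bag g))
        coherent {v} v∈ {x} {y} p q = connected-⊎
          {Q₁ = λ g → g ∈ V D₁.T × v ∈ D₁.bag g}
          {Q₂ = λ g → g ∈ V D₂.T × v ∈ D₂.bag g}
          {R₁ = E (full D₁.T (λ g → v ∈ D₁.bag g))}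
          {R₂ = E (full D₂.T (λ g → v ∈ D₂.bag g))}
          (λ (e , p , q) → left e , p , q)
          (λ (e , p , q) → right e , p , q)
          (Graph.sym (full T (λ g → v ∈ bag g)))
          (λ (g∈ , p) → D₁.coherent (D₁.bag⊆V g∈ p) (g∈ , p))
          (λ (g∈ , p) → D₂.coherent (D₂.bag⊆V g∈ p) (g∈ , p))
          -- A vertex in bags of both trees lies in `S₁` and `S₂`, hence in the bags at `a` and `b`.
          (λ (g∈ , p) (h∈ , q) →
            let p′ , q′ = common v∈ (proj₂ (D₁.bag⊆V g∈ p)) (proj₂ (D₂.bag⊆V h∈ q))
            in  a , b , (a∈ , p′) , (b∈ , q′) , forward , p′ , q′)
          x y (split x p) (split y q)
          where
          split : ∀ g → g ∈ V T × v ∈ bag g →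
                  g ∈ [ (λ g → g ∈ V D₁.T × v ∈ D₁.bag g)
                      , (λ g → g ∈ V D₂.T × v ∈ D₂.bag g) ]′
          split (inj₁ _) p = p
          split (inj₂ _) p = p

      -- No bag is changed, so the largest bag size is the maximum of the two old ones.
      glueAt-width : ∀ {k w₁ w₂} → HasWidth D₁ w₁ → w₁ ≤ k → HasWidth D₂ w₂ → w₂ ≤ k →
                     WidthAtMost Γ k
      glueAt-width {k} (k₁ , ((x₁ , s₁) , max₁) , refl) w₁≤k
                       (k₂ , ((x₂ , s₂) , max₂) , refl) w₂≤k =
        glueAt , k₁ ℕ.⊔ k₂ ∸ 1 , (k₁ ℕ.⊔ k₂ , (attained , bounded) , refl) , ≤k
        where
        Node : Set
        Node = Σ[ g ∈ D₁.W ⊎ D₂.W ] g ∈ [ V D₁.T , V D₂.T ]′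

        size : Node → Pred ℕ 0ℓ
        size x = HasSize (TreeDecomposition.bag glueAt (proj₁ x))

        attained : ∃[ x ] size x (k₁ ℕ.⊔ k₂)
        attained with ⊔-sel k₁ k₂
        ... | inj₁ eq = (inj₁ (proj₁ x₁) , proj₂ x₁) , subst (HasSize _) (sym eq) s₁
        ... | inj₂ eq = (inj₂ (proj₁ x₂) , proj₂ x₂) , subst (HasSize _) (sym eq) s₂

        bounded : ∀ x → ∃[ m ] (size x m × m ≤ k₁ ℕ.⊔ k₂)
        bounded (inj₁ g , g∈) =
          let m , s , m≤ = max₁ (g , g∈) in m , s , ≤-trans m≤ (m≤m⊔n k₁ k₂)
        bounded (inj₂ g , g∈) =
          let m , s , m≤ = max₂ (g , g∈) in m , s , ≤-trans m≤ (m≤n⊔m k₁ k₂)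

        ≤k : k₁ ℕ.⊔ k₂ ∸ 1 ≤ k
        ≤k with ⊔-sel k₁ k₂
        ... | inj₁ eq = subst (λ m → m ∸ 1 ≤ k) (sym eq) w₁≤k
        ... | inj₂ eq = subst (λ m → m ∸ 1 ≤ k) (sym eq) w₂≤k

  -- If there is a common vertex `c`, the trees are joined at bags containing it; otherwise at
  -- arbitrary nodes.
  glue : ExcludedMiddle 0ℓ → Subsingleton (V Γ ∩ (S₁ ∩ S₂)) →
         ∀ {k} → WidthAtMost (full Γ S₁) k → WidthAtMost (full Γ S₂) k →
         WidthAtMost Γ k
  glue em atMostOne (D₁ , w₁ , width₁ , w₁≤k) (D₂ , w₂ , width₂ , w₂≤k)
    with em {∃[ c ] c ∈ V Γ ∩ (S₁ ∩ S₂)}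
  ... | yes (c , c∈@(c∈V , c∈S₁ , c∈S₂)) =
    let a , a∈ , c∈a = TreeDecomposition.vertex-cover D₁ (c∈V , c∈S₁)
        b , b∈ , c∈b = TreeDecomposition.vertex-cover D₂ (c∈V , c∈S₂)
    in  glueAt-width D₁ D₂ a∈ b∈
          (λ v∈V v∈S₁ v∈S₂ → let c≡v = atMostOne c∈ (v∈V , v∈S₁ , v∈S₂) in
            subst (TreeDecomposition.bag D₁ a) c≡v c∈a ,
            subst (TreeDecomposition.bag D₂ b) c≡v c∈b)
          width₁ w₁≤k width₂ w₂≤k
  ... | no none =
    let a , a∈ = IsTree.nonempty (TreeDecomposition.isTree D₁)
        b , b∈ = IsTree.nonempty (TreeDecomposition.isTree D₂)
    in  glueAt-width D₁ D₂ a∈ b∈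
          (λ v∈V v∈S₁ v∈S₂ → contradiction (_ , v∈V , v∈S₁ , v∈S₂) none)
          width₁ w₁≤k width₂ w₂≤k

-- Separation by at most one vertex

-- Since `C` may be empty, this includes connectedness of `Γ` itself, besides the absence of cut
-- vertices.
Nonseparable : Graph U → Set₁
Nonseparable Γ = ∀ {C} → Subsingleton C → Connected (full Γ (∁ C))

Separable : Graph U → Set₁
Separable {U} Γ = Σ[ C ∈ Pred U 0ℓ ] (Subsingleton C × ∃[ u ] ∃[ w ]
  (u ∈ V (full Γ (∁ C)) × w ∈ V (full Γ (∁ C)) × ¬ Star (E (full Γ (∁ C))) u w))

-- Nonseparable subgraphs of a tree-graded graph

module _ (em : ExcludedMiddle 0ℓ) {I : Set} {X : Graph U} {P : I → Graph U}
         (tg : TreeGraded X P) where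
  open TreeGraded tg

  -- Distinct pieces sharing an edge would share both its ends, which would then coincide, against
  -- irreflexivity.
  edge-determines-piece : ∀ {i j u v} → E (P i) u v → E (P j) u v → i ≡ j
  edge-determines-piece {i} {j} e e′ = decidable-stable em λ i≢j → disjoint i≢j
    where
    e⁻  = Graph.sym (P i) e
    e′⁻ = Graph.sym (P j) e′

    disjoint : i ≢ j → ⊥
    disjoint i≢j with intersection i≢j
    ... | inj₁ empty         = empty _ (Graph.E⇒V (P i) e , Graph.E⇒V (P j) e′)
    ... | inj₂ (c , ∩⊆c , _) = Graph.irrefl (P i)
      (trans (sym (∩⊆c (Graph.E⇒V (P i) e , Graph.E⇒V (P j) e′)))
             (∩⊆c (Graph.E⇒V (P i) e⁻ , Graph.E⇒V (P j) e′⁻)))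
      e

  module _ {Γ : Graph U} (Γ⊑X : Γ ⊑ X) (nonsep : Nonseparable Γ) where

    consecutive-edges : ∀ {i u v w} → E Γ u v → E Γ v w → E (P i) u v → E (P i) v w
    consecutive-edges {i} {u} {v} {w} uv vw uv∈Pi with em {u ≡ w}
    ... | yes refl = Graph.sym (P i) uv∈Pi
    ... | no u≢w   =
      let u∈ = Graph.E⇒V Γ uv , (λ v≡u → Graph.irrefl Γ (sym v≡u) uv)
          w∈ = Graph.E⇒V Γ (Graph.sym Γ vw) , (λ v≡w → Graph.irrefl Γ v≡w vw)
          path = nonsep {｛ v ｝} (λ v≡x v≡y → trans (sym v≡x) v≡y) u∈ w∈
          zs , linked , uniq = Star⇒simplePath (λ _ _ → em) path u≢w
          v∉ = Linked⇒All (λ (_ , _ , v≢y) → v≢y) (proj₂ u∈) linked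
          -- The loop is `v`, `u`, `zs`, `w`, `v`; the vertices `u` and `w` alone give the required
          -- length 2.
          loop = s≤s (subst (1 ≤_) (sym (length-++ zs)) (m≤n+m 1 (length zs)))
               , v∉ ∷ uniq
               , proj₂ Γ⊑X (Graph.sym Γ uv)
                 ∷ Linked-∷ʳ⁺ (u ∷ zs) (Linked.map (proj₂ Γ⊑X ∘ proj₁) linked)
                     (proj₂ Γ⊑X (Graph.sym Γ vw))
          -- The first edge of the loop identifies its piece `j` with `i`; its closing edge is then
          -- the one wanted.
          j , _ , _ , linked′ = simple-loop loop
          i≡j = edge-determines-piece uv∈Pi (Graph.sym (P j) (Linked.head linked′))
      in  subst (λ i → E (P i) v w) (sym i≡j)
            (Graph.sym (P j) (Linked-last (u ∷ zs) (Linked.tail linked′)))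

    private
      Γ-connected : Connected Γ
      Γ-connected v∈ w∈ =
        Star.map proj₁ (nonsep {∅} (λ ()) (v∈ , λ ()) (w∈ , λ ()))

      -- Transports membership in the piece along a walk. Starting from an edge rather than a vertex
      -- leaves an edge ending at `w` even for the empty walk.
      edge-into : ∀ {i u v w} → E Γ u v → E (P i) u v → Star (E Γ) v w →
                  ∃[ x ] (E Γ x w × E (P i) x w)
      edge-into uv uv∈Pi ε        = _ , uv , uv∈Pi
      edge-into uv uv∈Pi (vx ◅ p) =
        edge-into vx (consecutive-edges uv vx uv∈Pi) p

    nonseparable⇒⊑piece : I → ∃[ i ] Γ ⊑ P i
    nonseparable⇒⊑piece i₀ with em {∃[ u ] ∃[ v ] E Γ u v} | em {∃[ v ] v ∈ V Γ}
    ... | yes (u , v , uv) | _ =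
      let i , uv∈Pi = proj₁ edge-cover (proj₂ Γ⊑X uv)
          into = λ {w} (w∈ : w ∈ V Γ) →
                   edge-into uv uv∈Pi (Γ-connected (Graph.E⇒V Γ (Graph.sym Γ uv)) w∈)
      in  i ,
          (λ w∈ → let _ , _ , xw∈Pi = into w∈ in Graph.E⇒V (P i) (Graph.sym (P i) xw∈Pi)) ,
          (λ wy → let _ , xw , xw∈Pi = into (Graph.E⇒V Γ wy) in
                  consecutive-edges xw wy xw∈Pi)
    -- Connected without edges: `v` is the only vertex.
    ... | no noEdge | yes (v , v∈) =
      let i , v∈Pi = proj₁ vertex-cover (proj₁ Γ⊑X v∈)
      in  i , (λ w∈ → subst (V (P i)) (v≡ (Γ-connected v∈ w∈)) v∈Pi) ,
          λ e → contradiction (_ , _ , e) noEdge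
      where
      v≡ : ∀ {w} → Star (E Γ) v w → v ≡ w
      v≡ ε       = refl
      v≡ (e ◅ _) = contradiction (_ , _ , e) noEdge
    -- The empty graph lies in every piece; `i₀` supplies one.
    ... | no noEdge | no noVertex =
      i₀ , (λ v∈ → contradiction (_ , v∈) noVertex) ,
      λ e → contradiction (_ , _ , e) noEdge

-- Splitting along a separating set

HasSize-full : ExcludedMiddle 0ℓ → {Γ : Graph U} {S : Pred U 0ℓ} → ∀ {n v} →
               HasSize (V Γ) n → v ∈ V Γ → ¬ v ∈ S →
               ∃[ m ] (HasSize (V (full Γ S)) m × m < n)
HasSize-full em {S = S} (xs , uniq , (V⊆xs , xs⊆V) , refl) v∈ v∉S =
  _ ,
  ( filter S? xs , Uniqueₚ.filter⁺ S? uniq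
  , ( (λ (x∈V , x∈S) → ∈-filter⁺ S? (V⊆xs x∈V) x∈S)
    , (λ x∈ → let x∈xs , x∈S = ∈-filter⁻ S? x∈ in xs⊆V x∈xs , x∈S) )
  , refl ) ,
  filter-notAll S? xs (lose (V⊆xs v∈) v∉S)
  where
  S? = λ x → em {S x}

-- One part is `C` with the component of `u` outside `C`, the other is `C` with everything else.
-- They overlap only in `C`, so decompositions of the two parts glue.
separate : ExcludedMiddle 0ℓ → {Γ : Graph U} {C : Pred U 0ℓ} → Subsingleton C →
           ∀ {u w n} → u ∈ V (full Γ (∁ C)) → w ∈ V (full Γ (∁ C)) →
           ¬ Star (E (full Γ (∁ C))) u w → HasSize (V Γ) n →
           ∀ {k} → (∀ {S m} → HasSize (V (full Γ S)) m → m < n → WidthAtMost (full Γ S) k) →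
           WidthAtMost Γ k
separate {U = U} em {Γ} {C} atMostOne {u} {w} (u∈V , u∉C) (w∈V , w∉C) ¬path size decompose =
  -- Both parts are strictly smaller: the first misses `w`, the second misses `u`, which the empty
  -- path reaches.
  let _ , size₁ , m₁<n = HasSize-full em {Γ} {S₁} size w∈V [ w∉C , ¬path ]′
      _ , size₂ , m₂<n = HasSize-full em {Γ} {S₂} size u∈V [ u∉C , (λ ¬uu → ¬uu ε) ]′
  in  glue covers covers-edge em
        (λ (_ , p) (_ , q) → atMostOne (common p) (common q))
        (decompose size₁ m₁<n) (decompose size₂ m₂<n)
  where
  Reached : Pred U 0ℓ
  Reached x = Star (E (full Γ (∁ C))) u x

  S₁ S₂ : Pred U 0ℓ
  S₁ x = x ∈ C ⊎ x ∈ Reached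
  S₂ x = x ∈ C ⊎ ¬ x ∈ Reached

  common : ∀ {x} → x ∈ S₁ ∩ S₂ → x ∈ C
  common (inj₁ c , _)      = c
  common (inj₂ _ , inj₁ c) = c
  common (inj₂ p , inj₂ q) = contradiction p q

  covers : ∀ {x} → x ∈ V Γ → x ∈ S₁ ⊎ x ∈ S₂
  covers {x} _ with em {x ∈ Reached}
  ... | yes p = inj₁ (inj₂ p)
  ... | no ¬p = inj₂ (inj₂ ¬p)

  covers-edge : ∀ {x y} → E Γ x y → (x ∈ S₁ × y ∈ S₁) ⊎ (x ∈ S₂ × y ∈ S₂)
  covers-edge {x} {y} e with em {x ∈ C} | em {y ∈ C}
  ... | yes c | yes d = inj₁ (inj₁ c , inj₁ d)
  ... | yes c | no _ with covers (Graph.E⇒V Γ (Graph.sym Γ e))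
  ...   | inj₁ q = inj₁ (inj₁ c , q)
  ...   | inj₂ q = inj₂ (inj₁ c , q)
  covers-edge {x} {y} e | no _ | yes d with covers (Graph.E⇒V Γ e)
  ...   | inj₁ p = inj₁ (p , inj₁ d)
  ...   | inj₂ p = inj₂ (p , inj₁ d)
  -- An edge avoiding `C` joins vertices of the same component, so both ends are reached or neither
  -- is.
  covers-edge {x} {y} e | no x∉C | no y∉C with em {x ∈ Reached}
  ... | yes p = inj₁ (inj₂ p , inj₂ (p ◅◅ (e , x∉C , y∉C) ◅ ε))
  ... | no ¬p = inj₂ (inj₂ ¬p , inj₂ λ q →
                  ¬p (q ◅◅ (Graph.sym Γ e , y∉C , x∉C) ◅ ε))

-- Comparing treewidth profiles

module _ (em : ExcludedMiddle (lsuc 0ℓ)) where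

  em₀ : ExcludedMiddle 0ℓ
  em₀ = map′ lower (lift {ℓ = lsuc 0ℓ}) em

  nonseparable-or-separable : (Γ : Graph U) → Nonseparable Γ ⊎ Separable Γ
  nonseparable-or-separable Γ with em {Separable Γ}
  ... | yes separable = inj₂ separable
  ... | no none       = inj₁ λ {C} sub u∈ w∈ → decidable-stable em₀ λ ¬path →
                          none (C , (λ {x} {y} → sub {x} {y}) , _ , _ , u∈ , w∈ , ¬path)

  -- Strong induction on the number of vertices: a nonseparable graph lies in a piece, where
  -- `inPiece` applies, and a separable one splits into smaller subgraphs of `X`.
  widthAtMost-from-pieces :
    {I : Set} {X : Graph U} {P : I → Graph U} → I → TreeGraded X P → ∀ {r k} →
    (∀ {Γ n} i → Γ ⊑ P i → HasSize (V Γ) n → n ≤ r → WidthAtMost Γ k) →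
    ∀ n {Γ} → Γ ⊑ X → HasSize (V Γ) n → n ≤ r → WidthAtMost Γ k
  widthAtMost-from-pieces {X = X} i₀ tg {r} {k} inPiece = <-rec _ step
    where
    step : ∀ n → (∀ {m} → m < n → ∀ {Γ} → Γ ⊑ X → HasSize (V Γ) m → m ≤ r → WidthAtMost Γ k) →
           ∀ {Γ} → Γ ⊑ X → HasSize (V Γ) n → n ≤ r → WidthAtMost Γ k
    step n rec {Γ} Γ⊑X size n≤r with nonseparable-or-separable Γ
    ... | inj₁ nonsep =
      let i , Γ⊑Pi = nonseparable⇒⊑piece em₀ tg {Γ} Γ⊑X (λ {C} → nonsep {C}) i₀
      in  inPiece i Γ⊑Pi size n≤r
    ... | inj₂ (C , sub , u , w , u∈ , w∈ , ¬path) =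
      separate em₀ sub u∈ w∈ ¬path size λ size′ m<n →
        rec m<n (proj₁ Γ⊑X ∘ proj₁ , proj₂ Γ⊑X ∘ proj₁) size′ (≤-trans (<⇒≤ m<n) n≤r)

  -- A single bag bounds each treewidth by the number of vertices, hence by `r`, so the maximum
  -- exists. The empty subgraph ensures that there is something to maximise over.
  profile≤ : (X : Graph U) → ∀ r → ∃[ k ] (IsProfile X r k × k ≤ r)
  profile≤ {U = U} X r = maximum≤ em empty r λ S →
    let n , size , n≤r = SubgraphOfSize≤.small S
        m , tw , m≤n   = treewidth≤ em (singleBag size)
    in  m , tw , ≤-trans m≤n n≤r
    where
    empty : SubgraphOfSize≤ r X
    empty = record
      { Γ     = record { V = ∅ ; E = λ _ _ → ⊥ ; E⇒V = λ () ; sym = λ () ; irrefl = λ _ () }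
      ; Γ⊑X   = (λ ()) , λ ()
      ; small = 0 , ([] , [] , ((λ ()) , λ ()) , refl) , z≤n
      }

proposition1p6 : ExcludedMiddle (lsuc 0ℓ) →
    {U I : Set} (X : Graph U) (P : I → Graph U) →
    I → TreeGraded X P →
    ∀ (r : ℕ) →
    ∃[ k ] (IsProfile X r k × IsMaximum (λ i → IsProfile (P i) r) k)
proposition1p6 em X P i₀ tg r =
  let k , max@((i , (S , tw) , _) , profiles) , _ =
        maximum≤ em i₀ r (λ i → profile≤ em (P i) r)
      open SubgraphOfSize≤
      Pi⊑X = TreeGraded.subgraph tg i
      -- The subgraph attaining the maximum in piece `i` is also a subgraph of `X`, so `k` is
      -- attained there.
      S′ = record
        { Γ     = Γ S
        ; Γ⊑X   = proj₁ Pi⊑X ∘ proj₁ (Γ⊑X S) , proj₂ Pi⊑X ∘ proj₂ (Γ⊑X S)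
        ; small = small S
        }
      -- An optimal decomposition of a subgraph of a piece has width at most that piece's profile
      -- value, hence at most `k`.
      inPiece = λ {Γ′} {n} i Γ′⊑Pi size n≤r →
        let kᵢ , (_ , tws) , kᵢ≤k = profiles i
            m , ((D , width) , _) , m≤kᵢ =
              tws (record { Γ = Γ′ ; Γ⊑X = Γ′⊑Pi ; small = n , size , n≤r })
        in  D , m , width , ≤-trans m≤kᵢ kᵢ≤k
  in  k ,
      ( (S′ , tw)
      , λ S″ → let n , size , n≤r = small S″ in
          treewidth≤ em
            (widthAtMost-from-pieces em i₀ tg inPiece n (Γ⊑X S″) size n≤r) ) ,
      max
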